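{- Let $k\geq 2$ and $n\geq 2k+1$ be integers, and let $C_n^k$ denote the circulant graph $Ci_n(1,2,\dots,k)$. Then \[ tvs(C_n^k)=\left\lceil\frac{n+2k}{2k+1}\right\rceil. \]
   Context: For integers $n$ and $1\le k\le n/2$, the circulant graph $Ci_n(1,2,\dots,k)$ (the $k$-th power $C_n^k$ of the cycle $C_n$) is the simple graph with vertex set $\{0,1,\dots,n-1\}$ in which $x$ is adjacent to $x\pm i \pmod n$ for every $1\le i\le k$; it is $2k$-regular when $n\ge 2k+1$. For a simple graph $G$, a total labelling $w:V(G)\cup E(G)\to\{1,2,\dots,s\}$ assigns to each vertex $v$ the weighted degree $wd(v)=w(v)+\sum_{e\ni v}w(e)$; the labelling is called (vertex) irregular if the weighted degrees of all vertices are pairwise distinct. The total vertex irregularity strength $tvs(G)$ is the smallest integer $s$ for which such an irregular total labelling with labels in $\{1,\dots,s\}$ exists. -}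

module Defs where

open import Data.Nat using (ℕ; zero; suc; _+_; _*_; _∸_; _≤_; _<_; _/_; NonZero)
open import Data.Nat.DivMod using (_%_)
open import Data.Fin using (Fin; toℕ; fromℕ<)
open import Data.Nat.DivMod using (m%n<n)
open import Data.List using (List; []; _∷_; _++_; map; upTo)
open import Data.Nat.ListAction using (sum)
open import Data.Product using (Σ; _×_; _,_)
open import Relation.Binary.PropositionalEquality using (_≡_)
open import Relation.Nullary using (¬_)
open import Data.List.Membership.Propositional using (_∈_)

plusMod : (n : ℕ) .{{_ : NonZero n}} → Fin n → ℕ → Fin n
plusMod n x i = fromℕ< (m%n<n (toℕ x + i) n)

minusMod : (n : ℕ) .{{_ : NonZero n}} → Fin n → ℕ → Fin n
minusMod n x i = fromℕ< (m%n<n (toℕ x + (n ∸ (i % n))) n)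

dists : ℕ → List ℕ
dists k = map suc (upTo k)

-- Neighbour list of x in Ci_n(1,…,k): x+i and x-i for 1 ≤ i ≤ k.
-- (For n ≥ 2k+1 these 2k vertices are pairwise distinct, so this is
-- exactly the neighbourhood, each neighbour listed once.)
nbrs : (n k : ℕ) .{{_ : NonZero n}} → Fin n → List (Fin n)
nbrs n k x = map (plusMod n x) (dists k) ++ map (minusMod n x) (dists k)

Adj : (n k : ℕ) .{{_ : NonZero n}} → Fin n → Fin n → Set
Adj n k x y = y ∈ nbrs n k x

record TotalLabelling (n k s : ℕ) .{{_ : NonZero n}} : Set where
  field
    wv     : Fin n → ℕ
    we     : Fin n → Fin n → ℕ
    we-sym : ∀ x y → Adj n k x y → we x y ≡ we y x
    wv-range : ∀ x → 1 ≤ wv x × wv x ≤ s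
    we-range : ∀ x y → Adj n k x y → 1 ≤ we x y × we x y ≤ s

wd : {n k s : ℕ} .{{_ : NonZero n}} → TotalLabelling n k s → Fin n → ℕ
wd {n} {k} L x = TotalLabelling.wv L x + sum (map (TotalLabelling.we L x) (nbrs n k x))

Irregular : {n k s : ℕ} .{{_ : NonZero n}} → TotalLabelling n k s → Set
Irregular L = ∀ x y → wd L x ≡ wd L y → x ≡ y

Admits : (n k s : ℕ) .{{_ : NonZero n}} → Set
Admits n k s = Σ (TotalLabelling n k s) Irregular

IsTvs : (n k t : ℕ) .{{_ : NonZero n}} → Set
IsTvs n k t = Admits n k t × (∀ s → Admits n k s → t ≤ s)

ceilDiv : ℕ → (b : ℕ) .{{_ : NonZero b}} → ℕ
ceilDiv a b = (a + (b ∸ 1)) / b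

{-# OPTIONS --safe #-}
-- Write q = 2k + 1; the claim is that labels up to s suffice iff n + 2k ≤ s q.
-- Necessity is the pigeonhole principle, as all weighted degrees lie in [q, s q].
-- For sufficiency, fold the cycle: give the vertices 0, -1, 1, -2, 2, … the heights
-- h = 0, 1, 2, 3, 4, …  For a threshold c with k ≤ c and c + k < n, put an extra unit on every
-- vertex x with h x > c and every edge x y whose mean height exceeds c.  If no fold interferes,
-- the neighbours x ± i have heights h x ± 2 i, so x receives one unit for each of the 2k + 1
-- integers in [h x - k, h x + k] that exceeds c, i.e. min (h x + k ∸ c, q) units; the bounds
-- on c make this remain true around both folds.  Starting from all labels equal to 1 and using
-- thresholds at most q apart, every unit step in height lies on one of these ramps, so the
-- weighted degree is strictly increasing in the height.
module Submission where

open import Defs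
open import Data.Nat using (ℕ; zero; suc; _+_; _*_; _∸_; _⊓_; _/_; _%_; _≤_; _<_; z≤n; s≤s; _<?_; _≤?_; NonZero; >-nonZero⁻¹)
open import Data.Nat.DivMod using (m≡m%n+[m/n]*n; m%n<n; m<n⇒m%n≡m; [m+n]%n≡m%n; m/n*n≤m; m<n*o⇒m/o<n)
open import Data.Nat.ListAction using (sum)
open import Data.Nat.ListAction.Properties using (sum-++)
open import Data.Nat.Properties
open import Data.Nat.Tactic.RingSolver using (solve)
open import Data.Fin using (Fin; toℕ; fromℕ<)
open import Data.Fin.Properties using (toℕ<n; toℕ-fromℕ<; toℕ-injective; injective⇒≤)
open import Data.List using ([]; _∷_; _++_; _∷ʳ_; length; map; upTo)
open import Data.List.Membership.Propositional using (_∈_)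
open import Data.List.Properties using (map-++; map-∘; length-++; length-map; length-upTo; upTo-∷ʳ)
open import Data.List.Relation.Unary.Any using (here; there)
open import Data.Product using (_×_; _,_; proj₁; proj₂)
open import Data.Sum using (_⊎_; inj₁; inj₂)
open import Function using (_∘_)
open import Relation.Binary.Definitions using (tri<; tri≈; tri>)
open import Relation.Binary.PropositionalEquality
open import Relation.Nullary using (yes; no; contradiction)

-- Linear arithmetic by certificate: `l ≤ r` is one known inequality or a sum of several, `c` is the
-- slack, and the remaining identity is left to the ring solver.
≤-combine : ∀ {l r a b} c → l ≤ r → a + r + c ≡ b + l → a ≤ b
≤-combine {l} {r} {a} {b} c l≤r eq = +-cancelʳ-≤ l a b
  (≤-trans (+-monoʳ-≤ a l≤r) (≤-trans (m≤m+n (a + r) c) (≤-reflexive eq)))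

≡-combine : ∀ {l r a b} → l ≡ r → a + r ≡ b + l → a ≡ b
≡-combine {l} {r} {a} {b} l≡r eq = +-cancelʳ-≡ l a b (trans (cong (a +_) l≡r) eq)

-- With *-monoʳ-≤ in its place the ring solver sees an unreduced application in its goals.
double-≤ : ∀ {m n} → m ≤ n → 2 * m ≤ 2 * n
double-≤ = *-monoʳ-≤ 2

+-interchange : ∀ a b c d → a + b + (c + d) ≡ a + c + (b + d)
+-interchange a b c d = solve (a ∷ b ∷ c ∷ d ∷ [])

-- Sums over lists

sum-map-+ : ∀ {A : Set} (f g : A → ℕ) xs →
  sum (map (λ x → f x + g x) xs) ≡ sum (map f xs) + sum (map g xs)
sum-map-+ f g []       = refl
sum-map-+ f g (x ∷ xs) rewrite sum-map-+ f g xs = +-interchange (f x) (g x) _ _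

sum-map-bounds : ∀ {A : Set} (f : A → ℕ) s xs → (∀ {x} → x ∈ xs → 1 ≤ f x × f x ≤ s) →
  length xs ≤ sum (map f xs) × sum (map f xs) ≤ length xs * s
sum-map-bounds f s []       f∈ = z≤n , z≤n
sum-map-bounds f s (x ∷ xs) f∈ with f∈ (here refl) | sum-map-bounds f s xs (f∈ ∘ there)
... | 1≤fx , fx≤s | lower , upper = +-mono-≤ 1≤fx lower , +-mono-≤ fx≤s upper

-- Splits off the largest distance, whereas list recursion exposes the smallest; the induction in
-- `degree-step` widens a window and needs the largest last.
sum-map-dists-suc : ∀ (f : ℕ → ℕ) j → sum (map f (dists (suc j))) ≡ sum (map f (dists j)) + f (suc j)
sum-map-dists-suc f j = begin
  sum (map f (map suc (upTo (suc j))))                ≡⟨ cong (sum ∘ map f ∘ map suc) (upTo-∷ʳ j) ⟨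
  sum (map f (map suc (upTo j ∷ʳ j)))                 ≡⟨ cong (sum ∘ map f) (map-++ suc (upTo j) _) ⟩
  sum (map f (dists j ∷ʳ suc j))                      ≡⟨ cong sum (map-++ f (dists j) _) ⟩
  sum (map f (dists j) ∷ʳ f (suc j))                  ≡⟨ sum-++ (map f (dists j)) _ ⟩
  sum (map f (dists j)) + (f (suc j) + 0)             ≡⟨ cong (sum (map f (dists j)) +_) (+-identityʳ _) ⟩
  sum (map f (dists j)) + f (suc j)                   ∎
  where open ≡-Reasoning

module _ (n k : ℕ) .{{_ : NonZero n}} where

  length-nbrs : ∀ x → length (nbrs n k x) ≡ 2 * k
  length-nbrs x = begin
    length (nbrs n k x)                 ≡⟨ length-++ (map (plusMod n x) (dists k)) ⟩
    length (map (plusMod n x) (dists k)) + length (map (minusMod n x) (dists k))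
      ≡⟨ cong₂ _+_ (length-map-dists (plusMod n x)) (length-map-dists (minusMod n x)) ⟩
    k + k                               ≡⟨ cong (k +_) (+-identityʳ k) ⟨
    2 * k                               ∎
    where
    open ≡-Reasoning
    length-map-dists : ∀ (f : ℕ → Fin n) → length (map f (dists k)) ≡ k
    length-map-dists f = trans (length-map f (dists k)) (trans (length-map suc (upTo k)) (length-upTo k))

  -- The two neighbours at each distance are paired because their joint contribution will not depend
  -- on which half of the cycle `x` lies in.
  sum-nbrs : ∀ (f : Fin n → ℕ) x →
    sum (map f (nbrs n k x)) ≡ sum (map (λ i → f (plusMod n x i) + f (minusMod n x i)) (dists k))
  sum-nbrs f x = begin
    sum (map f (nbrs n k x))
      ≡⟨ cong sum (map-++ f (map (plusMod n x) (dists k)) _) ⟩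
    sum (map f (map (plusMod n x) (dists k)) ++ map f (map (minusMod n x) (dists k)))
      ≡⟨ sum-++ (map f (map (plusMod n x) (dists k))) _ ⟩
    sum (map f (map (plusMod n x) (dists k))) + sum (map f (map (minusMod n x) (dists k)))
      ≡⟨ cong₂ (λ as bs → sum as + sum bs) (map-∘ (dists k)) (map-∘ (dists k)) ⟨
    sum (map (f ∘ plusMod n x) (dists k)) + sum (map (f ∘ minusMod n x) (dists k))
      ≡⟨ sum-map-+ (f ∘ plusMod n x) (f ∘ minusMod n x) (dists k) ⟨
    sum (map (λ i → f (plusMod n x i) + f (minusMod n x i)) (dists k)) ∎
    where open ≡-Reasoning

-- The lower bound

  module _ {s : ℕ} (L : TotalLabelling n k s) where
    open TotalLabelling L

    wd-bounds : ∀ x → suc (2 * k) ≤ wd L x × wd L x ≤ s * suc (2 * k)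
    wd-bounds x with wv-range x | sum-map-bounds (we x) s (nbrs n k x) (we-range x _)
    ... | 1≤v , v≤s | lower , upper rewrite length-nbrs x =
      +-mono-≤ 1≤v lower ,
      ≤-trans (+-mono-≤ v≤s upper) (≤-reflexive (solve (s ∷ k ∷ [])))

    -- With q = 2k + 1, subtracting q maps the distinct weighted degrees injectively into a set of s
    -- q - q + 1 elements.
    irregular⇒n+2k≤s*q : Irregular L → n + 2 * k ≤ s * suc (2 * k)
    irregular⇒n+2k≤s*q irr = begin
      n + 2 * k                                             ≤⟨ +-monoˡ-≤ (2 * k) (injective⇒≤ excess-injective) ⟩
      suc (s * suc (2 * k) ∸ suc (2 * k)) + 2 * k           ≡⟨ +-suc _ (2 * k) ⟨
      s * suc (2 * k) ∸ suc (2 * k) + suc (2 * k)           ≡⟨ m∸n+n≡m q≤s*q ⟩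
      s * suc (2 * k)                                       ∎
      where
      open ≤-Reasoning
      -- The weighted degree of vertex 0 lies between the two sides.
      q≤s*q : suc (2 * k) ≤ s * suc (2 * k)
      q≤s*q = let (lower , upper) = wd-bounds (fromℕ< (>-nonZero⁻¹ n)) in ≤-trans lower upper
      excess< : ∀ x → wd L x ∸ suc (2 * k) < suc (s * suc (2 * k) ∸ suc (2 * k))
      excess< x = s≤s (∸-monoˡ-≤ (suc (2 * k)) (proj₂ (wd-bounds x)))
      excess : Fin n → Fin (suc (s * suc (2 * k) ∸ suc (2 * k)))
      excess x = fromℕ< (excess< x)
      excess-injective : ∀ {x y} → excess x ≡ excess y → x ≡ y
      excess-injective {x} {y} eq = irr x y
        (∸-cancelʳ-≡ (proj₁ (wd-bounds x)) (proj₁ (wd-bounds y))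
          (trans (sym (toℕ-fromℕ< (excess< x))) (trans (cong toℕ eq) (toℕ-fromℕ< (excess< y)))))

-- Step functions and their sums over a window

-- The indicator of `t ≤ s`, written as a truncated minimum to match the shape of `window`.
step : ℕ → ℕ → ℕ
step t s = 1 ⊓ (suc s ∸ t)

step-on : ∀ {t s} → t ≤ s → step t s ≡ 1
step-on t≤s = m≤n⇒m⊓n≡m (m<n⇒0<n∸m (s≤s t≤s))

step-off : ∀ {t s} → s < t → step t s ≡ 0
step-off s<t = cong (1 ⊓_) (m≤n⇒m∸n≡0 s<t)

step≤1 : ∀ t s → step t s ≤ 1
step≤1 t s = m⊓n≤m 1 (suc s ∸ t)

step-shift : ∀ i t s → step (i + t) (i + s) ≡ step t s
step-shift i t s = cong (1 ⊓_) (trans (cong (_∸ (i + t)) (sym (+-suc i s))) ([m+n]∸[m+o]≡n∸o i (suc s) t))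

-- Edges are tested on the sum of their end heights, where a mean above `c` reads as a sum of at
-- least 2c + 1; an even sum 2r passes exactly when r > c.
step-double : ∀ c r → step (suc (2 * c)) (2 * r) ≡ step (suc c) r
step-double c r with c <? r
... | yes c<r = trans (step-on (*-monoʳ-< 2 c<r)) (sym (step-on c<r))
... | no  c≮r = trans (step-off (s≤s (double-≤ (≮⇒≥ c≮r)))) (sym (step-off (s≤s (≮⇒≥ c≮r))))

-- The number of integers in [u - j, u + j] that exceed c.
window : ℕ → ℕ → ℕ → ℕ
window c u j = (u + j ∸ c) ⊓ suc (2 * j)

window-zero : ∀ c u → step (suc c) u ≡ window c u 0
window-zero c u rewrite +-identityʳ u = ⊓-comm 1 (u ∸ c)

-- The new integers are u + (j + 1) and u - (j + 1); the second is tested against `c` by moving the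
-- subtraction to the threshold. The cases are: no integer of the wider window exceeds `c`, all do,
-- or `c` cuts through it and only the upper new one counts.
window-suc : ∀ c u j →
  window c u j + (step (suc c) (u + suc j) + step (suc (c + suc j)) u) ≡ window c u (suc j)
window-suc c u j with c <? u + suc j
... | no c≮ = trans
    (cong₂ _+_ (empty j (≤-trans (+-monoʳ-≤ u (n≤1+n j)) u+≤c))
      (cong₂ _+_ (step-off (s≤s u+≤c))
                 (step-off (s≤s (≤-trans (m≤m+n u (suc j)) (≤-trans u+≤c (m≤m+n c (suc j))))))))
    (sym (empty (suc j) u+≤c))
  where
  u+≤c = ≮⇒≥ c≮
  empty : ∀ i → u + i ≤ c → window c u i ≡ 0
  empty i le = cong (_⊓ suc (2 * i)) (m≤n⇒m∸n≡0 le)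
... | yes c< with c + suc j <? u
...   | yes full = trans
          (cong₂ _+_ (saturated j (≤-combine 1 full (solve (c ∷ u ∷ j ∷ []))))
            (cong₂ _+_ (step-on c<) (step-on full)))
          (trans (grow j)
            (sym (saturated (suc j) (≤-combine 0 full (solve (c ∷ u ∷ j ∷ []))))))
  where
  grow : ∀ j → suc (2 * j) + 2 ≡ suc (2 * suc j)
  grow j = solve (j ∷ [])
  saturated : ∀ i → suc (2 * i) + c ≤ u + i → window c u i ≡ suc (2 * i)
  saturated i le = m≥n⇒m⊓n≡n (m+n≤o⇒m≤o∸n (suc (2 * i)) le)
...   | no ¬full = trans
          (cong₂ _+_ (partial j (≤-combine 0 u≤ (solve (c ∷ u ∷ j ∷ []))))
            (cong₂ _+_ (step-on c<) (step-off (s≤s u≤))))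
          (trans (+-comm (u + j ∸ c) 1)
            (trans (sym (+-∸-assoc 1 (≤-combine {a = c} {u + j} 0 c< (solve (c ∷ u ∷ j ∷ [])))))
              (trans (cong (_∸ c) (sym (+-suc u j)))
                (sym (partial (suc j) (≤-combine 1 u≤ (solve (c ∷ u ∷ j ∷ []))))))))
  where
  u≤ = ≮⇒≥ ¬full
  partial : ∀ i → u + i ≤ c + suc (2 * i) → window c u i ≡ u + i ∸ c
  partial i le = m≤n⇒m⊓n≡m (m≤n+o⇒m∸n≤o (u + i) c le)

window-mono : ∀ c j {u v} → u ≤ v → window c u j ≤ window c v j
window-mono c j u≤v = ⊓-monoˡ-≤ (suc (2 * j)) (∸-monoˡ-≤ c (+-monoˡ-≤ j u≤v))

-- The bounds make the truncated subtraction exact and keep the minimum short of saturation.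
window-< : ∀ c u j → c ≤ u + j → u + j < c + suc (2 * j) → window c u j < window c (suc u) j
window-< c u j c≤ <c+q = begin-strict
  window c u j                        ≤⟨ m⊓n≤m (u + j ∸ c) _ ⟩
  u + j ∸ c                           <⟨ n<1+n _ ⟩
  suc (u + j ∸ c)                     ≡⟨ m≤n⇒m⊓n≡m (≤-trans (≤-reflexive (sym (+-∸-assoc 1 c≤))) (m≤n+o⇒m∸n≤o _ c <c+q)) ⟨
  suc (u + j ∸ c) ⊓ suc (2 * j)       ≡⟨ cong (_⊓ suc (2 * j)) (+-∸-assoc 1 c≤) ⟨
  window c (suc u) j                  ∎
  where open ≤-Reasoning

-- Heights

-- The minimum selects 2y when 2y < n; otherwise y stands for the vertex -(n - y) and gets 2(n - y)
-- - 1.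
height : ℕ → ℕ → ℕ
height n y = 2 * y ⊓ (2 * n ∸ suc (2 * y))

height-low : ∀ {n} y → 2 * y < n → height n y ≡ 2 * y
height-low {n} y 2y<n = m≤n⇒m⊓n≡m (m+n≤o⇒m≤o∸n (2 * y) 4y<2n)
  where
  4y<2n : 2 * y + suc (2 * y) ≤ 2 * n
  4y<2n = ≤-combine 1 (+-mono-≤ 2y<n 2y<n) (solve (n ∷ y ∷ []))

height-high : ∀ {n} y → n ≤ 2 * y → y < n → height n y + suc (2 * y) ≡ 2 * n
height-high {n} y n≤2y y<n = trans
  (cong (_+ suc (2 * y)) (m≥n⇒m⊓n≡n (m≤n+o⇒m∸n≤o (2 * n) (suc (2 * y)) 2n≤1+4y)))
  (m∸n+n≡m (≤-trans (≤-reflexive (sym (+-suc y (y + 0)))) (+-mono-≤ (<⇒≤ y<n) (+-monoˡ-< 0 y<n))))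
  where
  2n≤1+4y : 2 * n ≤ suc (2 * y) + 2 * y
  2n≤1+4y = ≤-combine 1 (+-mono-≤ n≤2y n≤2y) (solve (n ∷ y ∷ []))

height<n : ∀ {n} y → y < n → height n y < n
height<n {n} y y<n with 2 * y <? n
... | yes low = <-≤-trans (s≤s (≤-reflexive (height-low y low))) low
... | no high = below (≮⇒≥ high) (height-high y (≮⇒≥ high) y<n)
  where
  below : ∀ {h} → n ≤ 2 * y → h + suc (2 * y) ≡ 2 * n → h < n
  below {h} n≤2y eq = ≤-combine 0 (+-mono-≤ n≤2y (≤-reflexive eq)) (solve (n ∷ y ∷ h ∷ []))

-- Parity: heights are even on the low half and odd on the high half.
low≢high : ∀ {n} y z → 2 * y < n → n ≤ 2 * z → z < n → height n y ≢ height n z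
low≢high {n} y z low high z<n eq = even≢odd n (y + z) (begin
  2 * n                         ≡⟨ height-high z high z<n ⟨
  height n z + suc (2 * z)      ≡⟨ cong (_+ suc (2 * z)) (trans (sym eq) (height-low y low)) ⟩
  2 * y + suc (2 * z)           ≡⟨ solve (y ∷ z ∷ []) ⟩
  suc (2 * (y + z))             ∎)
  where open ≡-Reasoning

height-injective : ∀ {n y z} → y < n → z < n → height n y ≡ height n z → y ≡ z
height-injective {n} {y} {z} y<n z<n eq with 2 * y <? n | 2 * z <? n
... | yes p | yes q = *-cancelˡ-≡ y z 2 (trans (sym (height-low y p)) (trans eq (height-low z q)))
... | no p  | no q  = *-cancelˡ-≡ y z 2 (suc-injective (+-cancelˡ-≡ (height n y) _ _
    (trans (height-high y (≮⇒≥ p) y<n) (sym (trans (cong (_+ suc (2 * z)) eq) (height-high z (≮⇒≥ q) z<n))))))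
... | yes p | no q  = contradiction eq (low≢high y z p (≮⇒≥ q) z<n)
... | no p  | yes q = contradiction (sym eq) (low≢high z y q (≮⇒≥ p) y<n)

-- The second alternative in each case describes an edge passing over a fold.
Above Below : (n i u v : ℕ) → Set
Above n i u v = v ≡ u + 2 * i ⊎ (u + v + suc (2 * i) ≡ 2 * n × n ≤ u + 2 * i)
Below n i u v = u ≡ v + 2 * i ⊎ u + v + 1 ≡ 2 * i

-- Away from the fold the mean height is u + i. Over the upper fold both indicators are 1: the sum
-- 2n - 1 - 2i is at least 2c + 1, and u + i ≥ n - i > c.
step-above : ∀ {n k c i u v} → c + k < n → i ≤ k → Above n i u v →
  step (suc (2 * c)) (u + v) ≡ step (suc c) (u + i)
step-above {n} {k} {c} {i} {u} _ _ (inj₁ refl) =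
  trans (cong (step (suc (2 * c))) (double u i)) (step-double c (u + i))
  where
  double : ∀ u i → u + (u + 2 * i) ≡ 2 * (u + i)
  double u i = solve (u ∷ i ∷ [])
step-above {n} {k} {c} {i} {u} {v} c+k<n i≤k (inj₂ (eq , n≤)) = trans
  (step-on {suc (2 * c)} {u + v} (≤-combine 0 (+-mono-≤ (+-mono-≤ (≤-reflexive (sym eq)) (+-mono-≤ c+k<n c+k<n)) (double-≤ i≤k))
    (solve (n ∷ k ∷ c ∷ i ∷ u ∷ v ∷ []))))
  (sym (step-on {suc c} {u + i} (≤-combine 0 (+-mono-≤ (+-mono-≤ n≤ c+k<n) i≤k) (solve (n ∷ k ∷ c ∷ i ∷ u ∷ [])))))

-- Away from the fold the mean height is u - i. Over the lower fold both indicators are 0: the sum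
-- 2i - 1 is below 2c, and u ≤ 2i - 1 < c + i.
step-below : ∀ {n k c i u v} → k ≤ c → i ≤ k → Below n i u v →
  step (suc (2 * c)) (u + v) ≡ step (suc (c + i)) u
step-below {n} {k} {c} {i} {v = v} _ _ (inj₁ refl) = begin
  step (suc (2 * c)) (v + 2 * i + v)      ≡⟨ cong (step (suc (2 * c))) (double v i) ⟩
  step (suc (2 * c)) (2 * (i + v))        ≡⟨ step-double c (i + v) ⟩
  step (suc c) (i + v)                    ≡⟨ step-shift i (suc c) (i + v) ⟨
  step (i + suc c) (i + (i + v))          ≡⟨ cong₂ step (shift c i) (unshift v i) ⟩
  step (suc (c + i)) (v + 2 * i)          ∎
  where
  open ≡-Reasoning
  double : ∀ v i → v + 2 * i + v ≡ 2 * (i + v)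
  double v i = solve (v ∷ i ∷ [])
  shift : ∀ c i → i + suc c ≡ suc (c + i)
  shift c i = solve (c ∷ i ∷ [])
  unshift : ∀ v i → i + (i + v) ≡ v + 2 * i
  unshift v i = solve (v ∷ i ∷ [])
step-below {n} {k} {c} {i} {u} {v} k≤c i≤k (inj₂ eq) = trans
  (step-off {suc (2 * c)} {u + v} (≤-combine 1 (+-mono-≤ (+-mono-≤ (≤-reflexive eq) (double-≤ i≤k)) (double-≤ k≤c))
    (solve (k ∷ c ∷ i ∷ u ∷ v ∷ []))))
  (sym (step-off {suc (c + i)} {u} (≤-combine (v + 1) (+-mono-≤ (+-mono-≤ (≤-reflexive eq) i≤k) k≤c)
    (solve (k ∷ c ∷ i ∷ u ∷ v ∷ [])))))

-- Positions of the neighbours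

low+i<n : ∀ {n i} X → 2 * X < n → 2 * i < n → X + i < n
low+i<n {n} {i} X low 2i<n = *-cancelˡ-< 2 (X + i) n (≤-combine 1 (+-mono-≤ low 2i<n) (solve (X ∷ i ∷ n ∷ [])))

low-low : ∀ {i u v} y → u ≡ 2 * y → v ≡ 2 * (y + i) → v ≡ u + 2 * i
low-low {i} y refl refl = solve (y ∷ i ∷ [])

high-high : ∀ {n i u v} y → u + suc (2 * y) ≡ 2 * n → v + suc (2 * (y + i)) ≡ 2 * n → u ≡ v + 2 * i
high-high {n} {i} {u} {v} y eu ev = ≡-combine (trans eu (sym ev)) (solve (y ∷ i ∷ u ∷ v ∷ []))

low-high : ∀ {n i u v} y → u ≡ 2 * y → v + suc (2 * (y + i)) ≡ 2 * n → u + v + suc (2 * i) ≡ 2 * n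
low-high {n} {i} {v = v} y refl ev = ≡-combine ev (solve (y ∷ i ∷ v ∷ n ∷ []))

-- The edge passes between positions n - 1 and 0, where the heights are lowest. The wrap equation is
-- used twice because heights double positions.
low-high-wrap : ∀ {n i u v} y z → z + i ≡ y + n → u ≡ 2 * y → v + suc (2 * z) ≡ 2 * n → u + v + 1 ≡ 2 * i
low-high-wrap {n} {i} {v = v} y z e refl ev =
  ≡-combine (cong₂ _+_ ev (sym (cong₂ _+_ e e))) (solve (y ∷ z ∷ v ∷ i ∷ n ∷ []))

above-low : ∀ {n i} X → 2 * X < n → 2 * i < n → Above n i (height n X) (height n (X + i))
above-low {n} {i} X low 2i<n with 2 * (X + i) <? n
... | yes p = inj₁ (low-low X (height-low X low) (height-low (X + i) p))
... | no p = inj₂ (low-high {n} X (height-low X low) (height-high (X + i) (≮⇒≥ p) (low+i<n X low 2i<n)) ,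
                   ≤-trans (≮⇒≥ p) (≤-reflexive (low-low X (height-low X low) refl)))

below-low : ∀ {n i} X y → y + i ≡ X → 2 * X < n → Below n i (height n X) (height n y)
below-low {n} {i} X y refl low =
  inj₁ (low-low y (height-low y (≤-<-trans (double-≤ (m≤m+n y i)) low)) (height-low X low))

below-low-wrap : ∀ {n i} X y → y + i ≡ X + n → y < n → 2 * X < n → 2 * i < n →
  Below n i (height n X) (height n y)
below-low-wrap {n} {i} X y e y<n low 2i<n =
  inj₂ (low-high-wrap {n} X y e (height-low X low) (height-high y n≤2y y<n))
  where
  n≤2y : n ≤ 2 * y
  n≤2y = ≤-combine (2 * X + 1) (+-mono-≤ (double-≤ (≤-reflexive (sym e))) 2i<n) (solve (X ∷ y ∷ n ∷ i ∷ []))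

below-high : ∀ {n i} X → n ≤ 2 * X → X + i < n → Below n i (height n X) (height n (X + i))
below-high {n} {i} X high y<n = inj₁ (high-high {n} X
  (height-high X high (≤-<-trans (m≤m+n X i) y<n))
  (height-high (X + i) (≤-trans high (double-≤ (m≤m+n X i))) y<n))

below-high-wrap : ∀ {n i} X y → X + i ≡ y + n → X < n → n ≤ 2 * X → 2 * i < n →
  Below n i (height n X) (height n y)
below-high-wrap {n} {i} X y e X<n high 2i<n = inj₂ (trans
  (cong (_+ 1) (+-comm (height n X) (height n y)))
  (low-high-wrap {n} y X e (height-low y 2y<n) (height-high X high X<n)))
  where
  2y<n : 2 * y < n
  2y<n = ≤-combine 2
    (+-mono-≤ (+-mono-≤ (double-≤ (≤-reflexive (sym e))) (+-mono-≤ X<n X<n)) 2i<n)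
    (solve (X ∷ y ∷ n ∷ i ∷ []))

above-high : ∀ {n i} X y → y + i ≡ X → X < n → n ≤ 2 * X → Above n i (height n X) (height n y)
above-high {n} {i} X y refl X<n high with 2 * y <? n
... | no p = inj₁ (high-high {n} y (height-high y (≮⇒≥ p) (≤-<-trans (m≤m+n y i) X<n)) (height-high X high X<n))
... | yes p = inj₂ (trans (cong (_+ suc (2 * i)) (+-comm (height n X) (height n y)))
                          (low-high {n} y (height-low y p) (height-high X high X<n)) ,
                    below-peak (height-high X high X<n))
  where
  below-peak : ∀ {u} → u + suc (2 * (y + i)) ≡ 2 * n → n ≤ u + 2 * i
  below-peak {u} eq = ≤-combine 0 (+-mono-≤ p (≤-reflexive (sym eq))) (solve (y ∷ u ∷ i ∷ n ∷ []))

-- Heights of the neighbours under modular addition and subtraction.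

module _ {n : ℕ} .{{_ : NonZero n}} where

  ht : Fin n → ℕ
  ht x = height n (toℕ x)

  %-unique : ∀ {m y} → y < n → m ≡ y ⊎ m ≡ y + n → m % n ≡ y
  %-unique y<n (inj₁ refl) = m<n⇒m%n≡m y<n
  %-unique y<n (inj₂ refl) = trans ([m+n]%n≡m%n _ n) (m<n⇒m%n≡m y<n)

  toℕ-plusMod : ∀ x i {y} → y < n → toℕ x + i ≡ y ⊎ toℕ x + i ≡ y + n → toℕ (plusMod n x i) ≡ y
  toℕ-plusMod x i y<n eq = trans (toℕ-fromℕ< (m%n<n (toℕ x + i) n)) (%-unique y<n eq)

  toℕ-minusMod : ∀ x {i y} → i < n → y < n → y + i ≡ toℕ x ⊎ y + i ≡ toℕ x + n → toℕ (minusMod n x i) ≡ y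
  toℕ-minusMod x {i} {y} i<n y<n eq = trans (toℕ-fromℕ< (m%n<n (toℕ x + (n ∸ i % n)) n))
    (trans (cong (λ r → (toℕ x + (n ∸ r)) % n) (m<n⇒m%n≡m i<n)) (%-unique y<n (unwrap eq)))
    where
    d = n ∸ i
    i+d≡n : i + d ≡ n
    i+d≡n = m+[n∸m]≡n (<⇒≤ i<n)
    direct : ∀ X d → y + i ≡ X → i + d ≡ n → X + d ≡ y + n
    direct X d e₁ e₂ = ≡-combine (cong₂ _+_ (sym e₁) e₂) (solve (X ∷ d ∷ y ∷ i ∷ n ∷ []))
    wrapped : ∀ X d → y + i ≡ X + n → i + d ≡ n → X + d ≡ y
    wrapped X d e₁ e₂ = ≡-combine (cong₂ _+_ (sym e₁) e₂) (solve (X ∷ d ∷ y ∷ i ∷ n ∷ []))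
    -- Subtraction of `i` is implemented as addition of n - i, so the wrapped and unwrapped cases
    -- trade places.
    unwrap : y + i ≡ toℕ x ⊎ y + i ≡ toℕ x + n → toℕ x + d ≡ y ⊎ toℕ x + d ≡ y + n
    unwrap (inj₁ e) = inj₂ (direct (toℕ x) d e i+d≡n)
    unwrap (inj₂ e) = inj₁ (wrapped (toℕ x) d e i+d≡n)

  private
    shrink : ∀ {i} → 2 * i < n → i < n
    shrink {i} = ≤-<-trans (m≤m+n i (i + 0))

    wrap< : ∀ {y z m} → y + m ≡ z + n → z < m → y < n
    wrap< {y} {z} {m} e z<m = ≤-combine 0 (+-mono-≤ (≤-reflexive e) z<m) (solve (y ∷ z ∷ m ∷ n ∷ []))

  low-plusMod : ∀ x {i} → 2 * toℕ x < n → 2 * i < n → Above n i (ht x) (ht (plusMod n x i))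
  low-plusMod x {i} low 2i<n = subst (Above n i (ht x) ∘ height n)
    (sym (toℕ-plusMod x i (low+i<n (toℕ x) low 2i<n) (inj₁ refl)))
    (above-low (toℕ x) low 2i<n)

  low-minusMod : ∀ x {i} → 2 * toℕ x < n → 2 * i < n → Below n i (ht x) (ht (minusMod n x i))
  low-minusMod x {i} low 2i<n with i ≤? toℕ x
  ... | yes i≤x = subst (Below n i (ht x) ∘ height n)
    (sym (toℕ-minusMod x (shrink 2i<n) (≤-<-trans (m∸n≤m (toℕ x) i) (toℕ<n x)) (inj₁ (m∸n+n≡m i≤x))))
    (below-low (toℕ x) (toℕ x ∸ i) (m∸n+n≡m i≤x) low)
  ... | no i≰x = subst (Below n i (ht x) ∘ height n)
    (sym (toℕ-minusMod x (shrink 2i<n) y<n (inj₂ e)))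
    (below-low-wrap (toℕ x) (toℕ x + n ∸ i) e y<n low 2i<n)
    where
    e : toℕ x + n ∸ i + i ≡ toℕ x + n
    e = m∸n+n≡m (≤-trans (<⇒≤ (shrink {i} 2i<n)) (m≤n+m n (toℕ x)))
    y<n : toℕ x + n ∸ i < n
    y<n = wrap< e (≰⇒> i≰x)

  high-plusMod : ∀ x {i} → n ≤ 2 * toℕ x → 2 * i < n → Below n i (ht x) (ht (plusMod n x i))
  high-plusMod x {i} high 2i<n with toℕ x + i <? n
  ... | yes x+i<n = subst (Below n i (ht x) ∘ height n)
    (sym (toℕ-plusMod x i x+i<n (inj₁ refl)))
    (below-high (toℕ x) high x+i<n)
  ... | no x+i≮n = subst (Below n i (ht x) ∘ height n)
    (sym (toℕ-plusMod x i y<n (inj₂ e)))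
    (below-high-wrap (toℕ x) (toℕ x + i ∸ n) e (toℕ<n x) high 2i<n)
    where
    e : toℕ x + i ≡ toℕ x + i ∸ n + n
    e = sym (m∸n+n≡m (≮⇒≥ x+i≮n))
    y<n : toℕ x + i ∸ n < n
    y<n = ≤-<-trans (m≤n+o⇒m∸n≤o (toℕ x + i) n (+-monoˡ-≤ i (<⇒≤ (toℕ<n x)))) (shrink 2i<n)

  high-minusMod : ∀ x {i} → n ≤ 2 * toℕ x → 2 * i < n → Above n i (ht x) (ht (minusMod n x i))
  high-minusMod x {i} high 2i<n = subst (Above n i (ht x) ∘ height n)
    (sym (toℕ-minusMod x (shrink 2i<n) (≤-<-trans (m∸n≤m (toℕ x) i) (toℕ<n x)) (inj₁ e)))
    (above-high (toℕ x) (toℕ x ∸ i) e (toℕ<n x) high)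
    where
    e : toℕ x ∸ i + i ≡ toℕ x
    e = m∸n+n≡m (*-cancelˡ-≤ {i} 2 (≤-trans (<⇒≤ 2i<n) high))

  -- On the low half x + i plays the upper neighbour and x - i the lower one; on the high half the
  -- roles swap, which commutativity absorbs.
  step-neighbours : ∀ {k c i} x → 2 * k < n → k ≤ c → c + k < n → i ≤ k →
    step (suc (2 * c)) (ht x + ht (plusMod n x i)) + step (suc (2 * c)) (ht x + ht (minusMod n x i))
      ≡ step (suc c) (ht x + i) + step (suc (c + i)) (ht x)
  step-neighbours {k} {c} {i} x 2k<n k≤c c+k<n i≤k with 2 * toℕ x <? n
  ... | yes low = cong₂ _+_
    (step-above c+k<n i≤k (low-plusMod x low 2i<n))
    (step-below {n} k≤c i≤k (low-minusMod x low 2i<n))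
    where 2i<n = ≤-<-trans (double-≤ {i} i≤k) 2k<n
  ... | no ¬low = trans (+-comm _ (step (suc (2 * c)) (ht x + ht (minusMod n x i)))) (cong₂ _+_
    (step-above c+k<n i≤k (high-minusMod x (≮⇒≥ ¬low) 2i<n))
    (step-below {n} k≤c i≤k (high-plusMod x (≮⇒≥ ¬low) 2i<n)))
    where 2i<n = ≤-<-trans (double-≤ {i} i≤k) 2k<n

-- The labelling

module _ (n k : ℕ) .{{_ : NonZero n}} where

  -- The weighted degree when vertices and edges are labelled by w of the sum of their end heights.
  degree : (ℕ → ℕ) → Fin n → ℕ
  degree w x = w (ht x + ht x) + sum (map (λ y → w (ht x + ht y)) (nbrs n k x))

  -- Additivity in the weight lets each ramp be analysed separately.
  degree-+ : ∀ w w′ x → degree (λ s → w s + w′ s) x ≡ degree w x + degree w′ x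
  degree-+ w w′ x rewrite sum-map-+ (λ y → w (ht x + ht y)) (λ y → w′ (ht x + ht y)) (nbrs n k x) =
    +-interchange (w (ht x + ht x)) (w′ (ht x + ht x)) _ _

  degree-1 : ∀ x → degree (λ _ → 1) x ≡ suc (2 * k)
  degree-1 x with sum-map-bounds (λ _ → 1) 1 (nbrs n k x) (λ _ → ≤-refl , ≤-refl)
  ... | lower , upper rewrite length-nbrs n k x | *-identityʳ (2 * k) = cong suc (≤-antisym upper lower)

  -- The vertex itself gives the window of radius 0, and the pair of neighbours at distance i widens
  -- the radius from i - 1 to i.
  degree-step : ∀ {c} → 2 * k < n → k ≤ c → c + k < n → ∀ x →
    degree (step (suc (2 * c))) x ≡ window c (ht x) k
  degree-step {c} 2k<n k≤c c+k<n x =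
    trans (cong (own +_) (sum-nbrs n k _ x)) (partial-sum k ≤-refl)
    where
    own = step (suc (2 * c)) (ht x + ht x)
    pair : ℕ → ℕ
    pair i = step (suc (2 * c)) (ht x + ht (plusMod n x i)) + step (suc (2 * c)) (ht x + ht (minusMod n x i))
    partial-sum : ∀ j → j ≤ k → own + sum (map pair (dists j)) ≡ window c (ht x) j
    partial-sum zero _ = begin
      own + 0                                  ≡⟨ +-identityʳ own ⟩
      own                                      ≡⟨ cong (λ s → step (suc (2 * c)) (ht x + s)) (+-identityʳ (ht x)) ⟨
      step (suc (2 * c)) (2 * ht x)            ≡⟨ step-double c (ht x) ⟩
      step (suc c) (ht x)                      ≡⟨ window-zero c (ht x) ⟩
      window c (ht x) 0                        ∎
      where open ≡-Reasoning
    partial-sum (suc j) j<k = begin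
      own + sum (map pair (dists (suc j)))             ≡⟨ cong (own +_) (sum-map-dists-suc pair j) ⟩
      own + (sum (map pair (dists j)) + pair (suc j))  ≡⟨ +-assoc own _ _ ⟨
      own + sum (map pair (dists j)) + pair (suc j)    ≡⟨ cong₂ _+_ (partial-sum j (<⇒≤ j<k)) (step-neighbours x 2k<n k≤c c+k<n j<k) ⟩
      window c (ht x) j + _                            ≡⟨ window-suc c (ht x) j ⟩
      window c (ht x) (suc j)                          ∎
      where open ≡-Reasoning

  -- Consecutive ramps abut; the last ones are lowered so that they end by height n.
  offset : ℕ → ℕ
  offset l = l * suc (2 * k) ⊓ (n ∸ suc (2 * k))

  -- The shift by `k` makes the ramp `window (threshold l) u k` equal to
  -- `(u ∸ offset l) ⊓ suc (2 * k)`, so it starts rising at height `offset l`.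
  threshold : ℕ → ℕ
  threshold l = k + offset l

  label : ℕ → ℕ → ℕ
  label zero    s = 1
  label (suc l) s = label l s + step (suc (2 * threshold l)) s

  label-bounds : ∀ m s → 1 ≤ label m s × label m s ≤ suc m
  label-bounds zero    s = ≤-refl , ≤-refl
  label-bounds (suc m) s with label-bounds m s
  ... | lower , upper = ≤-trans lower (m≤m+n _ _) ,
    ≤-trans (+-mono-≤ upper (step≤1 (suc (2 * threshold m)) s)) (≤-reflexive (+-comm (suc m) 1))

  -- `degree-label` identifies this with the weighted degree under `label m` of a vertex at height
  -- `u`.
  profile : ℕ → ℕ → ℕ
  profile zero    u = suc (2 * k)
  profile (suc l) u = profile l u + window (threshold l) u k

  -- Strict growth of the weighted degree with the height.

  module _ (2k<n : 2 * k < n) where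

    -- The cap n - (2k + 1) in `offset` guarantees this.
    threshold+k<n : ∀ l → threshold l + k < n
    threshold+k<n l = begin-strict
      k + offset l + k                     ≡⟨ regroup (offset l) ⟩
      offset l + 2 * k                     <⟨ n<1+n _ ⟩
      suc (offset l + 2 * k)               ≡⟨ +-suc (offset l) (2 * k) ⟨
      offset l + suc (2 * k)               ≤⟨ +-monoˡ-≤ (suc (2 * k)) (m⊓n≤n (l * suc (2 * k)) _) ⟩
      n ∸ suc (2 * k) + suc (2 * k)        ≡⟨ m∸n+n≡m 2k<n ⟩
      n                                    ∎
      where
      open ≤-Reasoning
      regroup : ∀ a → k + a + k ≡ a + 2 * k
      regroup a = solve (a ∷ k ∷ [])

    degree-label : ∀ m x → degree (label m) x ≡ profile m (ht x)
    degree-label zero    x = degree-1 x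
    degree-label (suc m) x = trans (degree-+ (label m) (step (suc (2 * threshold m))) x)
      (cong₂ _+_ (degree-label m x) (degree-step 2k<n (m≤m+n k _) (threshold+k<n m) x))

    profile-mono : ∀ m {u v} → u ≤ v → profile m u ≤ profile m v
    profile-mono zero    u≤v = ≤-refl
    profile-mono (suc m) u≤v = +-mono-≤ (profile-mono m u≤v) (window-mono (threshold m) k u≤v)

    -- Ramp `l` rises strictly at this step and no other ramp descends.
    profile-ramp : ∀ m {l u} → l < m → offset l ≤ u → u < offset l + suc (2 * k) →
      profile m u < profile m (suc u)
    profile-ramp (suc m) {l} {u} l<1+m lower upper with m≤n⇒m<n∨m≡n (≤-pred l<1+m)
    ... | inj₁ l<m = +-mono-<-≤ (profile-ramp m l<m lower upper) (window-mono (threshold m) k (n≤1+n u))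
    ... | inj₂ refl = +-mono-≤-< (profile-mono m (n≤1+n u)) (window-< (threshold m) u k
      (≤-trans (≤-reflexive (+-comm k (offset m))) (+-monoˡ-≤ k lower))
      (≤-trans (+-monoˡ-< k upper) (≤-reflexive (rotate (offset m)))))
      where
      rotate : ∀ a → a + suc (2 * k) + k ≡ k + a + suc (2 * k)
      rotate a = solve (a ∷ k ∷ [])

    profile-suc : ∀ m {u} → n ≤ suc (m * suc (2 * k)) → suc u < n → profile m u < profile m (suc u)
    profile-suc m {u} n≤ 1+u<n = profile-ramp m l<m (≤-trans (m⊓n≤m _ _) l*q≤u) u<ramp-end
      where
      -- The uncapped ramp containing `u`; it is among the first `m` because u + 1 < n ≤ m q + 1
      -- with q = 2k + 1.
      l = u / suc (2 * k)
      l<m : l < m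
      l<m = m<n*o⇒m/o<n (≤-pred (≤-trans 1+u<n n≤))
      l*q≤u : l * suc (2 * k) ≤ u
      l*q≤u = m/n*n≤m u (suc (2 * k))
      u<next : u < l * suc (2 * k) + suc (2 * k)
      u<next = begin-strict
        u                                              ≡⟨ m≡m%n+[m/n]*n u (suc (2 * k)) ⟩
        u % suc (2 * k) + l * suc (2 * k)              <⟨ +-monoˡ-< (l * suc (2 * k)) (m%n<n u (suc (2 * k))) ⟩
        suc (2 * k) + l * suc (2 * k)                  ≡⟨ +-comm (suc (2 * k)) _ ⟩
        l * suc (2 * k) + suc (2 * k)                  ∎
        where open ≤-Reasoning
      u<ramp-end : u < offset l + suc (2 * k)
      -- A capped ramp starts no later than the uncapped one and ends at `n`, hence still covers
      -- `u`.
      u<ramp-end with ⊓-sel (l * suc (2 * k)) (n ∸ suc (2 * k))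
      ... | inj₁ eq rewrite eq = u<next
      ... | inj₂ eq rewrite eq | m∸n+n≡m 2k<n = <⇒≤ 1+u<n

    profile-< : ∀ m {u v} → n ≤ suc (m * suc (2 * k)) → u < v → v < n → profile m u < profile m v
    profile-< m n≤ u<v v<n = <-≤-trans (profile-suc m n≤ (≤-<-trans u<v v<n)) (profile-mono m u<v)

    profile-injective : ∀ m {u v} → n ≤ suc (m * suc (2 * k)) → u < n → v < n → profile m u ≡ profile m v → u ≡ v
    profile-injective m {u} {v} n≤ u<n v<n eq with <-cmp u v
    ... | tri< u<v _ _ = contradiction eq (<⇒≢ (profile-< m n≤ u<v v<n))
    ... | tri≈ _ u≡v _ = u≡v
    ... | tri> _ _ v<u = contradiction (sym eq) (<⇒≢ (profile-< m n≤ v<u u<n))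

    labelling : ∀ m → TotalLabelling n k (suc m)
    labelling m = record
      { wv       = λ x → label m (ht x + ht x)
      ; we       = λ x y → label m (ht x + ht y)
      ; we-sym   = λ x y _ → cong (label m) (+-comm (ht x) (ht y))
      ; wv-range = λ x → label-bounds m (ht x + ht x)
      ; we-range = λ x y _ → label-bounds m (ht x + ht y)
      }

    labelling-irregular : ∀ m → n ≤ suc (m * suc (2 * k)) → Irregular (labelling m)
    labelling-irregular m n≤ x y eq = toℕ-injective (height-injective (toℕ<n x) (toℕ<n y)
      (profile-injective m n≤ (height<n (toℕ x) (toℕ<n x)) (height<n (toℕ y) (toℕ<n y))
        (trans (sym (degree-label m x)) (trans eq (degree-label m y)))))

    n+2k≤s*q⇒admits : ∀ s → n + 2 * k ≤ s * suc (2 * k) → Admits n k s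
    n+2k≤s*q⇒admits zero    le = contradiction (≤-trans (m≤m+n n (2 * k)) le) (<⇒≱ (>-nonZero⁻¹ n))
    -- Removing 2k from both sides of n + 2k ≤ (m + 1)(2k + 1) leaves n ≤ 1 + m (2k + 1).
    n+2k≤s*q⇒admits (suc m) le = labelling m , labelling-irregular m (≤-combine 0 le (solve (n ∷ k ∷ m ∷ [])))

-- Ceiling division and the theorem.

m≤ceilDiv*n : ∀ m b → m ≤ ceilDiv m (suc b) * suc b
m≤ceilDiv*n m b = +-cancelˡ-≤ b m _ (begin
  b + m                                                     ≡⟨ +-comm b m ⟩
  m + b                                                     ≡⟨ m≡m%n+[m/n]*n (m + b) (suc b) ⟩
  -- The remainder is at most `b`, exactly the amount added before dividing.
  (m + b) % suc b + ceilDiv m (suc b) * suc b               ≤⟨ +-monoˡ-≤ _ (≤-pred (m%n<n (m + b) (suc b))) ⟩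
  b + ceilDiv m (suc b) * suc b                             ∎)
  where open ≤-Reasoning

m≤s*n⇒ceilDiv≤s : ∀ m b s → m ≤ s * suc b → ceilDiv m (suc b) ≤ s
m≤s*n⇒ceilDiv≤s m b s le = ≤-pred (m<n*o⇒m/o<n (begin-strict
  m + b               <⟨ +-mono-≤-< le (n<1+n b) ⟩
  s * suc b + suc b   ≡⟨ +-comm (s * suc b) (suc b) ⟩
  suc s * suc b       ∎))
  where open ≤-Reasoning

theorem1p2 : (k n : ℕ) → 2 ≤ k → 2 * k + 1 ≤ n → .{{_ : NonZero n}} →
    IsTvs n k (ceilDiv (n + 2 * k) (suc (2 * k)))
theorem1p2 k n _ 2k+1≤n =
  n+2k≤s*q⇒admits n k (≤-trans (≤-reflexive (+-comm 1 (2 * k))) 2k+1≤n) _ (m≤ceilDiv*n (n + 2 * k) (2 * k)) ,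
  λ s (L , irr) → m≤s*n⇒ceilDiv≤s (n + 2 * k) (2 * k) s (irregular⇒n+2k≤s*q n k L irr)
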